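{- For an integer $n\ge4$, let $\Delta^3_n$ be the simplicial complex on vertex set $\{\pm1,\dots,\pm n\}$ whose facets are all the following $4$-element sets together with their images under the antipodal map $v\mapsto -v$: (a) $\{i,i+1,n-1,n\}$ and $\{ -i,-i-1,n-1,n\}$ for $1\le i\le n-3$; and $\{1,-(n-2),n-1,n\}$, $\{1,-(n-2),-(n-1),n\}$, $\{1,-(n-2),-(n-1),-n\}$; (b) for every $\ell$ with $5\le\ell\le n$: $\{i,i+1,\ell-2,\ell\}$ and $\{ -i,-i-1,\ell-2,\ell\}$ for $1\le i\le\ell-4$; and $\{1,-(\ell-3),\ell-2,\ell\}$, $\{\ell-3,\ell-2,\ell-1,-\ell\}$, $\{ -1,\ell-3,\ell-1,-\ell\}$; (c) $\{1,2,-3,4\}$, $\{1,2,3,-4\}$, $\{1,-2,3,-4\}$. Then for every $n\ge5$, $\Delta^3_n$ is not polytopal, i.e., there is no simplicial convex $4$-polytope whose boundary complex is combinatorially isomorphic to $\Delta^3_n$.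
   Context: $\Delta^3_n$ is Jockusch's centrally symmetric cs-$2$-neighborly simplicial $3$-sphere on $2n$ vertices. A simplicial complex is given by its facets; faces are all subsets of facets. Polytopal means isomorphic to the boundary complex of a simplicial convex polytope. -}

module Defs where

open import Level using (Level; _⊔_) renaming (suc to lsuc)
open import Algebra.Bundles using (CommutativeRing)
open import Relation.Binary.Core using (Rel)
open import Relation.Binary.Structures using (IsStrictTotalOrder)
open import Relation.Nullary using (¬_)
open import Data.Product using (Σ; ∃; _×_; _,_)
open import Data.Sum using (_⊎_)
open import Data.Fin as Fin using (Fin)
open import Data.Nat as ℕ using (ℕ; _∸_)
open import Data.Integer as ℤ using (ℤ; +_)
open import Data.List using (List; []; _∷_; _++_; map; concatMap; upTo)
open import Data.List.Membership.Propositional using (_∈_; _∉_)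
open import Data.List.Relation.Unary.Any using (Any)
open import Function.Bundles using (_⇔_)
open import Relation.Binary.PropositionalEquality using (_≡_; _≢_)

record OrderedField (c ℓ₁ ℓ₂ : Level) : Set (lsuc (c ⊔ ℓ₁ ⊔ ℓ₂)) where
  field
    commutativeRing : CommutativeRing c ℓ₁
  open CommutativeRing commutativeRing public
  field
    _<_                 : Rel Carrier ℓ₂
    <-isStrictTotalOrder : IsStrictTotalOrder _≈_ _<_
    +-monoˡ-<           : ∀ {x y} z → x < y → (x + z) < (y + z)
    *-pos               : ∀ {x y} → 0# < x → 0# < y → 0# < (x * y)
    0<1                 : 0# < 1#
    inverse             : ∀ x → ¬ (x ≈ 0#) → ∃ λ y → (x * y) ≈ 1#

  _≤_ : Rel Carrier (ℓ₁ ⊔ ℓ₂)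
  x ≤ y = (x < y) ⊎ (x ≈ y)

IsComplete : ∀ {c ℓ₁ ℓ₂} → OrderedField c ℓ₁ ℓ₂ → Set (lsuc c ⊔ ℓ₁ ⊔ ℓ₂)
IsComplete {c} F =
  (S : Carrier → Set c) → (∃ S) → (∃ λ u → IsUpperBound S u) →
  ∃ λ s → IsUpperBound S s × (∀ u → IsUpperBound S u → s ≤ u)
  where
  open OrderedField F
  IsUpperBound : (Carrier → Set c) → Carrier → Set _
  IsUpperBound S u = ∀ x → S x → x ≤ u

module Det {c ℓ₁ ℓ₂} (F : OrderedField c ℓ₁ ℓ₂) where
  open OrderedField F

  Point : Set c
  Point = Fin 4 → Carrier

  _-ᵥ_ : Point → Point → Point
  (u -ᵥ v) i = u i - v i

  det3 : (a b c : Carrier × Carrier × Carrier) → Carrier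
  det3 (a1 , a2 , a3) (b1 , b2 , b3) (c1 , c2 , c3) =
    ((a1 * ((b2 * c3) - (b3 * c2))) - (a2 * ((b1 * c3) - (b3 * c1))))
      + (a3 * ((b1 * c2) - (b2 * c1)))

  -- determinant of the matrix with rows u, v, w, x (Laplace along column 0)
  det4 : Point → Point → Point → Point → Carrier
  det4 u v w x =
    (((u i0 * det3 (r v) (r w) (r x)) - (v i0 * det3 (r u) (r w) (r x)))
      + (w i0 * det3 (r u) (r v) (r x))) - (x i0 * det3 (r u) (r v) (r w))
    where
    i0 : Fin 4
    i0 = Fin.zero
    r : Point → Carrier × Carrier × Carrier
    r p = p (Fin.suc Fin.zero) , p (Fin.suc (Fin.suc Fin.zero)) , p (Fin.suc (Fin.suc (Fin.suc Fin.zero)))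

  orient : Point → Point → Point → Point → Point → Carrier
  orient a b c d e = det4 (b -ᵥ a) (c -ᵥ a) (d -ᵥ a) (e -ᵥ a)

pos neg : ℕ → ℤ
pos k = + k
neg k = ℤ.- (+ k)

-- [a, a+1, …, b]  (empty if b < a)
range : ℕ → ℕ → List ℕ
range a b = map (a ℕ.+_) (upTo (ℕ.suc b ∸ a))

vertices : ℕ → List ℤ
vertices n = map pos (range 1 n) ++ map neg (range 1 n)

Facet : Set
Facet = List ℤ

facetsA : ℕ → List Facet
facetsA n =
  concatMap (λ i → (pos i ∷ pos (ℕ.suc i) ∷ pos (n ∸ 1) ∷ pos n ∷ [])
                 ∷ (neg i ∷ neg (ℕ.suc i) ∷ pos (n ∸ 1) ∷ pos n ∷ []) ∷ [])
            (range 1 (n ∸ 3))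
  ++ (pos 1 ∷ neg (n ∸ 2) ∷ pos (n ∸ 1) ∷ pos n ∷ [])
   ∷ (pos 1 ∷ neg (n ∸ 2) ∷ neg (n ∸ 1) ∷ pos n ∷ [])
   ∷ (pos 1 ∷ neg (n ∸ 2) ∷ neg (n ∸ 1) ∷ neg n ∷ [])
   ∷ []

facetsBℓ : ℕ → List Facet
facetsBℓ ℓ =
  concatMap (λ i → (pos i ∷ pos (ℕ.suc i) ∷ pos (ℓ ∸ 2) ∷ pos ℓ ∷ [])
                 ∷ (neg i ∷ neg (ℕ.suc i) ∷ pos (ℓ ∸ 2) ∷ pos ℓ ∷ []) ∷ [])
            (range 1 (ℓ ∸ 4))
  ++ (pos 1 ∷ neg (ℓ ∸ 3) ∷ pos (ℓ ∸ 2) ∷ pos ℓ ∷ [])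
   ∷ (pos (ℓ ∸ 3) ∷ pos (ℓ ∸ 2) ∷ pos (ℓ ∸ 1) ∷ neg ℓ ∷ [])
   ∷ (neg 1 ∷ pos (ℓ ∸ 3) ∷ pos (ℓ ∸ 1) ∷ neg ℓ ∷ [])
   ∷ []

facetsB : ℕ → List Facet
facetsB n = concatMap facetsBℓ (range 5 n)

facetsC : List Facet
facetsC =
    (pos 1 ∷ pos 2 ∷ neg 3 ∷ pos 4 ∷ [])
  ∷ (pos 1 ∷ pos 2 ∷ pos 3 ∷ neg 4 ∷ [])
  ∷ (pos 1 ∷ neg 2 ∷ pos 3 ∷ neg 4 ∷ [])
  ∷ []

facetsΔ : ℕ → List Facet
facetsΔ n = base ++ map (map antipode) base
  where
  base = facetsA n ++ facetsB n ++ facetsC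
  antipode : ℤ → ℤ
  antipode v = ℤ.- v

-- {a,b,c,d} (four distinct vertices) is a facet of Δ³ₙ
IsFacetΔ : ℕ → ℤ → ℤ → ℤ → ℤ → Set
IsFacetΔ n a b c d =
  Any (λ F → a ∈ F × b ∈ F × c ∈ F × d ∈ F) (facetsΔ n)

Distinct4 : ℤ → ℤ → ℤ → ℤ → Set
Distinct4 a b c d =
  a ≢ b × a ≢ c × a ≢ d × b ≢ c × b ≢ d × c ≢ d

-- Polytopality over an ordered field F.
--
-- A map p from the vertices of Δ³ₙ to F⁴ realizes Δ³ₙ as the boundary
-- complex of the simplicial 4-polytope conv(p(V)) iff for every 4-set
-- {a,b,c,d} of vertices: {a,b,c,d} is a facet of Δ³ₙ exactly when the
-- affine hyperplane through p(a),…,p(d) is strictly supporting, i.e. all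
-- other points p(w) lie strictly on one common side of it.

module _ {c ℓ₁ ℓ₂} (F : OrderedField c ℓ₁ ℓ₂) where
  open OrderedField F
  open Det F

  StrictlySupporting : ℕ → (ℤ → Point) → ℤ → ℤ → ℤ → ℤ → Set (ℓ₂)
  StrictlySupporting n p a b c d =
    ∀ w w' → w ∈ vertices n → w' ∈ vertices n →
      w ∉ (a ∷ b ∷ c ∷ d ∷ []) → w' ∉ (a ∷ b ∷ c ∷ d ∷ []) →
      0# < (orient (p a) (p b) (p c) (p d) (p w)
              * orient (p a) (p b) (p c) (p d) (p w'))

  RealizesΔ : ℕ → (ℤ → Point) → Set ℓ₂
  RealizesΔ n p =
    ∀ a b c d → a ∈ vertices n → b ∈ vertices n → c ∈ vertices n →
      d ∈ vertices n → Distinct4 a b c d →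
      IsFacetΔ n a b c d ⇔ StrictlySupporting n p a b c d

  PolytopalOver : ℕ → Set (c ⊔ ℓ₂)
  PolytopalOver n = ∃ λ (p : ℤ → Point) → RealizesΔ n p

{-# OPTIONS --safe #-}

-- For a facet abcd of a realization, the orientations of (a, b, c, d, w) have one
-- common sign for all other vertices w, and a ridge between two facets relates their
-- signs. Sixteen facets on the vertices ±1, …, ±5 belong to Δ³ₙ for every n ≥ 5; they
-- form two antipodal strongly connected pieces, so all orientations that they determine
-- are known up to a global sign and one relative sign. In either case, three-term
-- Grassmann–Plücker relations with five of the six signs known force further signs and
-- finally give one orientation both signs.
module Submission where

open import Defs
open import Data.Nat using (ℕ; _≤_)
open import Relation.Nullary using (¬_)

open import Level using (0ℓ; _⊔_)
open import Algebra.Bundles using (CommutativeRing)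
open import Data.Bool using (Bool; true; false; T; not; if_then_else_)
open import Data.Empty using (⊥)
open import Data.Fin using (Fin; zero; suc; #_; combine; inject₁)
open import Data.Integer as ℤ using (ℤ; +_; -[1+_]; _◃_; _⊖_)
import Data.Integer.Properties as ℤ
open import Data.List using (List; []; _∷_; _++_; map; filter; foldl)
open import Data.List.Membership.Propositional using (_∈_; _∉_)
open import Data.List.Membership.Propositional.Properties using (∈-filter⁻; ∈-upTo⁺; ∈-upTo⁻)
import Data.List.Membership.DecPropositional as DecMembership
open import Data.List.Relation.Binary.Subset.Propositional using (_⊆_)
import Data.List.Relation.Binary.Subset.Propositional.Properties as ⊆
open import Data.List.Relation.Unary.All as All using (All; []; _∷_)
import Data.List.Relation.Unary.All.Properties as All
open import Data.List.Relation.Unary.Any using (Any; any?)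
open import Data.Maybe using (nothing)
open import Data.Nat as ℕ using (zero; suc)
import Data.Nat.Properties as ℕ
open import Data.Product using (_×_; _,_; proj₁; proj₂)
open import Data.Sign as Sign using (Sign)
open import Data.Sum using (_⊎_; inj₁; inj₂)
open import Data.Vec as Vec using (Vec; []; _∷_; concat; tabulate; lookup)
import Data.Vec.Properties as Vec
open import Function.Bundles using (Equivalence)
open import Relation.Binary.Definitions using (tri<; tri≈; tri>)
open import Relation.Binary.PropositionalEquality as ≡ using (_≡_; _≢_)
open import Relation.Binary.Structures using (IsStrictTotalOrder)
open import Relation.Nullary.Decidable using (Dec; does; yes; no; ¬?; _×-dec_; _⊎-dec_; toWitness)
open import Tactic.RingSolver.Core.AlmostCommutativeRing using (fromCommutativeRing)
open import Tactic.RingSolver.Core.Polynomial.Parameters using (Homomorphism)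
open import Tactic.RingSolver.Core.Expression

-- Polynomial normal forms with integer coefficients

-- The ring solver cannot cancel over an abstract ring, whose elements it cannot test
-- for zero; with coefficients in ℤ it can.
module IntegerCoefficients {c ℓ} (R : CommutativeRing c ℓ) where
  open CommutativeRing R
  open import Algebra.Properties.Ring ring
  open import Algebra.Properties.Semiring.Mult semiring using (×-homo-+; ×1-homo-*) renaming (_×_ to _·_)
  open import Relation.Binary.Reasoning.Setoid setoid

  ⟪_⟫ : ℤ → Carrier
  ⟪ + n ⟫      = n · 1#
  ⟪ -[1+ n ] ⟫ = - (suc n · 1#)

  -- Integer multiplication treats signs and absolute values separately; `signed` lets the proof of
  -- `⟪⟫-*-homo` follow that split.
  signed : Sign → Carrier → Carrier
  signed Sign.+ x = x
  signed Sign.- x = - x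

  -- The induction step of `⊖-homo`, where both arguments drop by one.
  cancel-1 : ∀ x y → x - y ≈ (1# + x) - (1# + y)
  cancel-1 x y = begin
    x - y                       ≈⟨ +-identityˡ _ ⟨
    0# + (x - y)                ≈⟨ +-congʳ (-‿inverseʳ 1#) ⟨
    (1# - 1#) + (x - y)         ≈⟨ +-assoc _ _ _ ⟩
    1# + (- 1# + (x - y))       ≈⟨ +-congˡ (+-assoc _ _ _) ⟨
    1# + ((- 1# + x) - y)       ≈⟨ +-congˡ (+-congʳ (+-comm _ _)) ⟩
    1# + ((x - 1#) - y)         ≈⟨ +-congˡ (+-assoc _ _ _) ⟩
    1# + (x + (- 1# - y))       ≈⟨ +-assoc _ _ _ ⟨
    (1# + x) + (- 1# - y)       ≈⟨ +-congˡ (-‿+-comm 1# y) ⟩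
    (1# + x) - (1# + y)         ∎

  ⊖-homo : ∀ m n → ⟪ m ⊖ n ⟫ ≈ m · 1# - n · 1#
  ⊖-homo zero    zero    = sym (-‿inverseʳ 0#)
  ⊖-homo zero    (suc n) = sym (+-identityˡ _)
  ⊖-homo (suc m) zero    = sym (trans (+-congˡ -0#≈0#) (+-identityʳ _))
  ⊖-homo (suc m) (suc n) = begin
    ⟪ suc m ⊖ suc n ⟫  ≡⟨ ≡.cong ⟪_⟫ (ℤ.[1+m]⊖[1+n]≡m⊖n m n) ⟩
    ⟪ m ⊖ n ⟫          ≈⟨ ⊖-homo m n ⟩
    m · 1# - n · 1#    ≈⟨ cancel-1 _ _ ⟩
    suc m · 1# - suc n · 1# ∎

  ⟪⟫-+-homo : ∀ i j → ⟪ i ℤ.+ j ⟫ ≈ ⟪ i ⟫ + ⟪ j ⟫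
  ⟪⟫-+-homo (+ m)      (+ n)      = ×-homo-+ 1# m n
  ⟪⟫-+-homo (+ m)      -[1+ n ]   = ⊖-homo m (suc n)
  ⟪⟫-+-homo -[1+ m ]   (+ n)      = trans (⊖-homo n (suc m)) (+-comm _ _)
  ⟪⟫-+-homo -[1+ m ]   -[1+ n ]   = begin
    - (suc (suc (m ℕ.+ n)) · 1#)      ≡⟨ ≡.cong (λ k → - (suc k · 1#)) (≡.sym (ℕ.+-suc m n)) ⟩
    - ((suc m ℕ.+ suc n) · 1#)        ≈⟨ -‿cong (×-homo-+ 1# (suc m) (suc n)) ⟩
    - (suc m · 1# + suc n · 1#)       ≈⟨ -‿+-comm _ _ ⟨
    - (suc m · 1#) - (suc n · 1#)     ∎

  ◃-homo : ∀ s n → ⟪ s ◃ n ⟫ ≈ signed s (n · 1#)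
  ◃-homo Sign.+ zero    = refl
  ◃-homo Sign.+ (suc n) = refl
  ◃-homo Sign.- zero    = sym -0#≈0#
  ◃-homo Sign.- (suc n) = refl

  ⟪⟫-signed : ∀ i → ⟪ i ⟫ ≈ signed (ℤ.sign i) (ℤ.∣ i ∣ · 1#)
  ⟪⟫-signed (+ n)    = refl
  ⟪⟫-signed -[1+ n ] = refl

  signed-cong : ∀ s {x y} → x ≈ y → signed s x ≈ signed s y
  signed-cong Sign.+ = λ p → p
  signed-cong Sign.- = -‿cong

  signed-* : ∀ s t x y → signed (s Sign.* t) (x * y) ≈ signed s x * signed t y
  signed-* Sign.+ Sign.+ x y = refl
  signed-* Sign.+ Sign.- x y = -‿distribʳ-* x y
  signed-* Sign.- Sign.+ x y = -‿distribˡ-* x y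
  signed-* Sign.- Sign.- x y = begin
    x * y         ≈⟨ -‿involutive _ ⟨
    - - (x * y)   ≈⟨ -‿cong (-‿distribˡ-* x y) ⟩
    - (- x * y)   ≈⟨ -‿distribʳ-* (- x) y ⟩
    - x * - y     ∎

  ⟪⟫-*-homo : ∀ i j → ⟪ i ℤ.* j ⟫ ≈ ⟪ i ⟫ * ⟪ j ⟫
  ⟪⟫-*-homo i j = begin
    ⟪ i ℤ.* j ⟫
      ≈⟨ ◃-homo s (ℤ.∣ i ∣ ℕ.* ℤ.∣ j ∣) ⟩
    signed s ((ℤ.∣ i ∣ ℕ.* ℤ.∣ j ∣) · 1#)
      ≈⟨ signed-cong s (×1-homo-* ℤ.∣ i ∣ ℤ.∣ j ∣) ⟩
    signed s ((ℤ.∣ i ∣ · 1#) * (ℤ.∣ j ∣ · 1#))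
      ≈⟨ signed-* (ℤ.sign i) (ℤ.sign j) _ _ ⟩
    signed (ℤ.sign i) (ℤ.∣ i ∣ · 1#) * signed (ℤ.sign j) (ℤ.∣ j ∣ · 1#)
      ≈⟨ *-cong (⟪⟫-signed i) (⟪⟫-signed j) ⟨
    ⟪ i ⟫ * ⟪ j ⟫ ∎
    where s = ℤ.sign i Sign.* ℤ.sign j

  ⟪⟫-neg-homo : ∀ i → ⟪ ℤ.- i ⟫ ≈ - ⟪ i ⟫
  ⟪⟫-neg-homo (+ zero)  = sym -0#≈0#
  ⟪⟫-neg-homo (+ suc n) = refl
  ⟪⟫-neg-homo -[1+ n ]  = sym (-‿involutive _)

  isZero : ℤ → Bool
  isZero (+ zero) = true
  isZero _        = false

  isZero-sound : ∀ i → T (isZero i) → 0# ≈ ⟪ i ⟫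
  isZero-sound (+ zero) _ = refl

  homomorphism : Homomorphism 0ℓ 0ℓ c ℓ
  homomorphism = record
    { from = record { rawRing = ℤ.+-*-rawRing ; isZero = isZero }
    -- The abstract ring offers no zero test, hence `nothing`; cancellation comes from `isZero` on
    -- the coefficients.
    ; to = fromCommutativeRing R (λ _ → nothing)
    ; morphism = record
      { ⟦_⟧ = ⟪_⟫ ; +-homo = ⟪⟫-+-homo ; *-homo = ⟪⟫-*-homo ; -‿homo = ⟪⟫-neg-homo
      ; 0-homo = refl ; 1-homo = +-identityʳ 1# }
    ; Zero-C⟶Zero-R = isZero-sound
    }
  open import Tactic.RingSolver.Core.Polynomial.Base (Homomorphism.from homomorphism)
  open import Tactic.RingSolver.Core.Polynomial.Semantics homomorphism renaming (⟦_⟧ to ⟦_⟧ₚ)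
  open import Tactic.RingSolver.Core.Polynomial.Homomorphism homomorphism
  open import Algebra.Properties.Semiring.Exp.TCOptimised semiring using (^-congˡ)
  open Eval rawRing ⟪_⟫ public

  normalise : ∀ {n} → Expr ℤ n → Poly n
  normalise (Κ x)   = κ x
  normalise (Ι x)   = ι x
  normalise (x ⊕ y) = normalise x ⊞ normalise y
  normalise (x ⊗ y) = normalise x ⊠ normalise y
  normalise (⊝ x)   = ⊟ normalise x
  normalise (x ⊛ i) = normalise x ⊡ i

  normalise-correct : ∀ {n} (e : Expr ℤ n) ρ → ⟦ normalise e ⟧ₚ ρ ≈ ⟦ e ⟧ ρ
  normalise-correct (Κ x)   ρ = κ-hom x ρ
  normalise-correct (Ι x)   ρ = ι-hom x ρ
  normalise-correct (x ⊕ y) ρ = trans (⊞-hom (normalise x) (normalise y) ρ)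
    (+-cong (normalise-correct x ρ) (normalise-correct y ρ))
  normalise-correct (x ⊗ y) ρ = trans (⊠-hom (normalise x) (normalise y) ρ)
    (*-cong (normalise-correct x ρ) (normalise-correct y ρ))
  normalise-correct (⊝ x)   ρ = trans (⊟-hom (normalise x) ρ) (-‿cong (normalise-correct x ρ))
  normalise-correct (x ⊛ i) ρ = trans (⊡-hom (normalise x) i ρ) (^-congˡ i (normalise-correct x ρ))

  -- The normal forms have integer coefficients, so their equality can hold by `refl` although the
  -- ring is abstract.
  prove : ∀ {n} (ρ : Vec Carrier n) e₁ e₂ → normalise e₁ ≡ normalise e₂ → ⟦ e₁ ⟧ ρ ≈ ⟦ e₂ ⟧ ρ
  prove ρ e₁ e₂ eq = begin
    ⟦ e₁ ⟧ ρ              ≈⟨ normalise-correct e₁ ρ ⟨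
    ⟦ normalise e₁ ⟧ₚ ρ   ≡⟨ ≡.cong (λ q → ⟦ q ⟧ₚ ρ) eq ⟩
    ⟦ normalise e₂ ⟧ₚ ρ   ≈⟨ normalise-correct e₂ ρ ⟩
    ⟦ e₂ ⟧ ρ              ∎

-- Determinants as formal polynomials

module DeterminantExpressions (k : ℕ) where
  E : Set
  E = Expr ℤ (k ℕ.* 4)

  Row : Set
  Row = Fin 4 → E

  infixl 6 _⊟_
  _⊟_ : E → E → E
  x ⊟ y = x ⊕ (⊝ y)

  row : Fin k → Row
  row j i = Ι (combine j i)

  _⊟ᵥ_ : Row → Row → Row
  (u ⊟ᵥ v) i = u i ⊟ v i

  -- These expressions follow `det3`, `det4` and `orient` term by term, so that evaluating them
  -- gives the determinants definitionally.
  det3ᴱ : Row → Row → Row → E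
  det3ᴱ a b c =
    ((a (# 1) ⊗ ((b (# 2) ⊗ c (# 3)) ⊟ (b (# 3) ⊗ c (# 2))))
      ⊟ (a (# 2) ⊗ ((b (# 1) ⊗ c (# 3)) ⊟ (b (# 3) ⊗ c (# 1)))))
      ⊕ (a (# 3) ⊗ ((b (# 1) ⊗ c (# 2)) ⊟ (b (# 2) ⊗ c (# 1))))

  det4ᴱ : Row → Row → Row → Row → E
  det4ᴱ u v w x =
    (((u (# 0) ⊗ det3ᴱ v w x) ⊟ (v (# 0) ⊗ det3ᴱ u w x))
      ⊕ (w (# 0) ⊗ det3ᴱ u v x)) ⊟ (x (# 0) ⊗ det3ᴱ u v w)

  orientᴱ : Row → Row → Row → Row → Row → E
  orientᴱ a b c d e = det4ᴱ (b ⊟ᵥ a) (c ⊟ᵥ a) (d ⊟ᵥ a) (e ⊟ᵥ a)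

-- 5-tuples up to even permutation

Tuple : Set
Tuple = Vec ℤ 5

swap : Fin 4 → Tuple → Tuple
swap zero                   (a ∷ b ∷ c ∷ d ∷ e ∷ []) = b ∷ a ∷ c ∷ d ∷ e ∷ []
swap (suc zero)             (a ∷ b ∷ c ∷ d ∷ e ∷ []) = a ∷ c ∷ b ∷ d ∷ e ∷ []
swap (suc (suc zero))       (a ∷ b ∷ c ∷ d ∷ e ∷ []) = a ∷ b ∷ d ∷ c ∷ e ∷ []
swap (suc (suc (suc zero))) (a ∷ b ∷ c ∷ d ∷ e ∷ []) = a ∷ b ∷ c ∷ e ∷ d ∷ []

compareSwap : Bool × Tuple → Fin 4 → Bool × Tuple
compareSwap (s , t) i =
  if lookup t (inject₁ i) ℤ.≤ᵇ lookup t (suc i) then (s , t) else (not s , swap i t)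

bubbleSort : List (Fin 4)
bubbleSort = # 0 ∷ # 1 ∷ # 2 ∷ # 3 ∷ # 0 ∷ # 1 ∷ # 2 ∷ # 0 ∷ # 1 ∷ # 0 ∷ []

-- An odd sort is completed by one further transposition, so `sortEvenly` picks one representative
-- for all even rearrangements of five distinct entries.
unsign : Bool × Tuple → Tuple
unsign (true  , t) = t
unsign (false , t) = swap zero t

-- Pitfall: an abbreviation for sortEvenly bubbleSort makes conversion checking
-- unfold ten nested comparisons of variables, so the network stays an argument.
sortEvenly : List (Fin 4) → Tuple → Tuple
sortEvenly is t = unsign (foldl compareSwap (true , t) is)

-- Facets present for every n ≥ 5

V : List ℤ
V = vertices 5

-- Family (a) moves with n, whereas family (c) and the block ℓ = 5 of family (b) occur for every n ≥
-- 5.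
facetsFixed : List Facet
facetsFixed = half ++ map (map (λ v → ℤ.- v)) half
  where
  half : List Facet
  half = facetsBℓ 5 ++ facetsC

open DecMembership ℤ._≟_ using () renaming (_∈?_ to _∈ℤ?_)

module KnownTuples where
  open DecMembership (Vec.≡-dec {n = 5} ℤ._≟_) using (_∈?_)

  Known : List Tuple → Tuple → Set
  Known K t = sortEvenly bubbleSort t ∈ K

  known? : ∀ K t → Dec (Known K t)
  known? K t = sortEvenly bubbleSort t ∈? K

open KnownTuples

FixedFacet : ℤ → ℤ → ℤ → ℤ → Set
FixedFacet a b c d = Any (λ F → a ∈ F × b ∈ F × c ∈ F × d ∈ F) facetsFixed

Crossable : ℤ → ℤ → ℤ → ℤ → ℤ → Set
Crossable a b c d w =
  FixedFacet a b c d × Distinct4 a b c d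
    × All (_∈ V) (a ∷ b ∷ c ∷ d ∷ []) × w ∈ V × w ∉ (a ∷ b ∷ c ∷ d ∷ [])

crossable? : ∀ a b c d w → Dec (Crossable a b c d w)
crossable? a b c d w =
  any? (λ F → (a ∈ℤ? F) ×-dec (b ∈ℤ? F) ×-dec (c ∈ℤ? F) ×-dec (d ∈ℤ? F)) facetsFixed
  ×-dec (≢? a b ×-dec ≢? a c ×-dec ≢? a d ×-dec ≢? b c ×-dec ≢? b d ×-dec ≢? c d)
  ×-dec All.all? (_∈ℤ? V) (a ∷ b ∷ c ∷ d ∷ [])
  ×-dec (w ∈ℤ? V) ×-dec ¬? (w ∈ℤ? (a ∷ b ∷ c ∷ d ∷ []))
  where
  ≢? : ∀ x y → Dec (x ≢ y)
  ≢? x y = ¬? (x ℤ.≟ y)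

-- Deduction of positive orientations

-- facet a b c d w: all vertices off the facet abcd lie on the same side as w.
-- plücker a b c p q x y: with [uv] the orientation of a b c u v,
-- [pq][xy] = [px][qy] + [py][xq], so [pq], [px][qy], [py][xq] > 0 give [xy] > 0.
data Step : Set where
  facet   : (a b c d w : ℤ) → Step
  plücker : (a b c p q x y : ℤ) → Step

-- A known tuple is a positive one, so t is negative when swap zero t is known.
SameSign : List Tuple → Tuple → Tuple → Set
SameSign K t u = (Known K t × Known K u) ⊎ (Known K (swap zero t) × Known K (swap zero u))

sameSign? : ∀ K t u → Dec (SameSign K t u)
sameSign? K t u =
  (known? K t ×-dec known? K u) ⊎-dec (known? K (swap zero t) ×-dec known? K (swap zero u))

-- A step whose premises fail adds nothing, so every list of steps is sound and a certificate is
-- tested only by its final contradiction.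
when : {P : Set} → Dec P → List Tuple → List Tuple
when P? ts = if does P? then ts else []

CrossPremises : List Tuple → (a b c d w : ℤ) → Set
CrossPremises K a b c d w = Known K (a ∷ b ∷ c ∷ d ∷ w ∷ []) × Crossable a b c d w

crossPremises? : ∀ K a b c d w → Dec (CrossPremises K a b c d w)
crossPremises? K a b c d w = known? K (a ∷ b ∷ c ∷ d ∷ w ∷ []) ×-dec crossable? a b c d w

cross : List Tuple → (a b c d w : ℤ) → List Tuple
cross K a b c d w = when (crossPremises? K a b c d w)
  (map (λ v → sortEvenly bubbleSort (a ∷ b ∷ c ∷ d ∷ v ∷ []))
       (filter (λ v → ¬? (v ∈ℤ? (a ∷ b ∷ c ∷ d ∷ []))) V))

ResolvePremises : List Tuple → (a b c p q x y : ℤ) → Set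
ResolvePremises K a b c p q x y =
  Known K (a ∷ b ∷ c ∷ p ∷ q ∷ [])
    × SameSign K (a ∷ b ∷ c ∷ p ∷ x ∷ []) (a ∷ b ∷ c ∷ q ∷ y ∷ [])
    × SameSign K (a ∷ b ∷ c ∷ p ∷ y ∷ []) (a ∷ b ∷ c ∷ x ∷ q ∷ [])

resolvePremises? : ∀ K a b c p q x y → Dec (ResolvePremises K a b c p q x y)
resolvePremises? K a b c p q x y =
  known? K (a ∷ b ∷ c ∷ p ∷ q ∷ [])
    ×-dec sameSign? K (a ∷ b ∷ c ∷ p ∷ x ∷ []) (a ∷ b ∷ c ∷ q ∷ y ∷ [])
    ×-dec sameSign? K (a ∷ b ∷ c ∷ p ∷ y ∷ []) (a ∷ b ∷ c ∷ x ∷ q ∷ [])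

resolve : List Tuple → (a b c p q x y : ℤ) → List Tuple
resolve K a b c p q x y =
  when (resolvePremises? K a b c p q x y) (sortEvenly bubbleSort (a ∷ b ∷ c ∷ x ∷ y ∷ []) ∷ [])

-- The facet may be listed in either orientation; at most one of the two applies.
extend : List Tuple → Step → List Tuple
extend K (facet a b c d w)       = cross K a b c d w ++ cross K b a c d w ++ K
extend K (plücker a b c p q x y) = resolve K a b c p q x y ++ K

-- Certificates for the two cases

-- One facet from each antipodal pair of `facetsFixed`. After the first, each shares a ridge with an
-- earlier one, and w is the vertex of that earlier facet missing from abcd.
crossings : List Step
crossings =
    facet (pos 1) (pos 2) (pos 3) (pos 5) (neg 5)
  ∷ facet (pos 1) (neg 2) (pos 3) (pos 5) (pos 2)
  ∷ facet (pos 1) (pos 2) (pos 3) (neg 4) (pos 5)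
  ∷ facet (pos 1) (neg 2) (pos 3) (neg 4) (pos 5)
  ∷ facet (pos 1) (neg 2) (neg 4) (pos 5) (pos 3)
  ∷ facet (neg 1) (neg 2) (pos 3) (neg 4) (pos 1)
  ∷ facet (neg 1) (neg 2) (pos 3) (pos 5) (pos 1)
  ∷ facet (neg 2) (neg 3) (neg 4) (pos 5) (pos 1)
  ∷ []

-- The fifth and the last step give opposite orientations on the vertices ±1, ±2, -4.
resolutions₊ : List Step
resolutions₊ =
    plücker (neg 4) (pos 1) (pos 2) (pos 3) (neg 3) (neg 5) (pos 4)
  ∷ plücker (neg 5) (pos 1) (pos 2) (neg 3) (pos 4) (neg 1) (neg 4)
  ∷ plücker (neg 5) (pos 1) (pos 2) (neg 3) (pos 3) (neg 4) (pos 5)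
  ∷ plücker (neg 4) (pos 1) (pos 2) (pos 3) (neg 5) (pos 5) (neg 1)
  ∷ plücker (neg 4) (pos 1) (pos 2) (pos 3) (pos 5) (neg 2) (neg 1)
  ∷ plücker (neg 4) (neg 2) (neg 1) (neg 3) (pos 3) (pos 4) (neg 5)
  ∷ plücker (neg 5) (neg 2) (neg 1) (pos 4) (neg 3) (neg 4) (pos 2)
  ∷ plücker (neg 5) (neg 2) (neg 1) (pos 3) (neg 3) (pos 5) (neg 4)
  ∷ plücker (neg 4) (neg 2) (neg 1) (neg 5) (pos 3) (pos 2) (pos 5)
  ∷ plücker (neg 4) (neg 2) (neg 1) (pos 5) (pos 3) (pos 2) (pos 1)
  ∷ []

witness₊ : Tuple
witness₊ = neg 4 ∷ neg 2 ∷ neg 1 ∷ pos 2 ∷ pos 1 ∷ []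

-- The first and the last step give opposite orientations on the vertices 1, 2, ±4, -5.
resolutions₋ : List Step
resolutions₋ =
    plücker (neg 4) (pos 1) (pos 2) (pos 3) (neg 3) (pos 4) (neg 5)
  ∷ plücker (neg 2) (neg 1) (pos 4) (pos 3) (neg 3) (pos 5) (neg 4)
  ∷ plücker (neg 4) (neg 2) (neg 1) (pos 5) (pos 3) (pos 4) (pos 1)
  ∷ plücker (neg 4) (neg 2) (neg 1) (neg 3) (pos 3) (neg 5) (pos 4)
  ∷ plücker (neg 2) (neg 1) (pos 4) (neg 5) (neg 3) (neg 4) (pos 2)
  ∷ plücker (neg 2) (neg 1) (pos 4) (neg 4) (neg 3) (pos 1) (pos 2)
  ∷ plücker (pos 1) (pos 2) (pos 4) (neg 3) (pos 3) (neg 4) (pos 5)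
  ∷ plücker (neg 4) (pos 1) (pos 2) (pos 3) (pos 5) (neg 2) (pos 4)
  ∷ plücker (pos 1) (pos 2) (pos 4) (neg 3) (neg 2) (neg 4) (neg 1)
  ∷ plücker (pos 1) (pos 2) (pos 4) (neg 3) (neg 1) (neg 4) (neg 5)
  ∷ []

witness₋ : Tuple
witness₋ = pos 1 ∷ pos 2 ∷ pos 4 ∷ neg 4 ∷ neg 5 ∷ []

antipode : Step → Step
antipode (facet a b c d w) = facet (ℤ.- a) (ℤ.- b) (ℤ.- c) (ℤ.- d) (ℤ.- w)
antipode (plücker a b c p q x y) =
  plücker (ℤ.- a) (ℤ.- b) (ℤ.- c) (ℤ.- p) (ℤ.- q) (ℤ.- x) (ℤ.- y)

-- The two balls have unrelated orientations: antiSeed may have either sign relative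
-- to seed, and resolutions₊, resolutions₋ refute the two cases.
seed antiSeed : Tuple
seed     = pos 1 ∷ pos 2 ∷ pos 3 ∷ pos 5 ∷ neg 5 ∷ []
antiSeed = neg 2 ∷ neg 1 ∷ neg 3 ∷ neg 5 ∷ pos 5 ∷ []

consequences : Tuple → List Step → List Tuple
consequences t steps =
  foldl extend (sortEvenly bubbleSort seed ∷ sortEvenly bubbleSort t ∷ []) (crossings ++ map antipode crossings ++ steps)

Contradictory : List Tuple → Tuple → Set
Contradictory K t = Known K t × Known K (swap zero t)

contradictory? : ∀ K t → Dec (Contradictory K t)
contradictory? K t = known? K t ×-dec known? K (swap zero t)

-- Evaluates the whole deduction on closed integer data; the ordered field enters only through
-- soundness.
contradiction₊ : Contradictory (consequences antiSeed resolutions₊) witness₊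
contradiction₊ = toWitness {a? = contradictory? (consequences antiSeed resolutions₊) witness₊} _

contradiction₋ : Contradictory (consequences (swap zero antiSeed) resolutions₋) witness₋
contradiction₋ = toWitness {a? = contradictory? (consequences (swap zero antiSeed) resolutions₋) witness₋} _

-- Sign rules in an ordered field

module OrderedFieldProperties {c ℓ₁ ℓ₂} (F : OrderedField c ℓ₁ ℓ₂) where
  open OrderedField F renaming (_<_ to infix 4 _<_)
  open IsStrictTotalOrder <-isStrictTotalOrder public
    using (compare; irrefl) renaming (trans to <-trans; <-respʳ-≈ to <-respʳ; <-respˡ-≈ to <-respˡ)
  open import Algebra.Properties.Ring ring

  +-pos : ∀ {x y} → 0# < x → 0# < y → 0# < x + y
  +-pos {x} {y} 0<x 0<y =
    <-trans 0<y (<-respˡ (+-identityˡ y) (+-monoˡ-< y 0<x))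

  x<0⇒0<-x : ∀ {x} → x < 0# → 0# < - x
  x<0⇒0<-x {x} x<0 =
    <-respˡ (-‿inverseʳ x) (<-respʳ (+-identityˡ (- x)) (+-monoˡ-< (- x) x<0))

  pos-neg-absurd : ∀ {x} → 0# < x → 0# < - x → ⊥
  pos-neg-absurd {x} 0<x 0<-x = irrefl refl (<-respʳ (-‿inverseʳ x) (+-pos 0<x 0<-x))

  *-pos-neg : ∀ {x y} → 0# < - x → 0# < - y → 0# < x * y
  *-pos-neg {x} {y} 0<-x 0<-y = <-respʳ eq (*-pos 0<-x 0<-y)
    where
    open import Relation.Binary.Reasoning.Setoid setoid
    eq : - x * - y ≈ x * y
    eq = begin
      - x * - y     ≈⟨ -‿distribʳ-* (- x) y ⟨
      - (- x * y)   ≈⟨ -‿cong (-‿distribˡ-* x y) ⟨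
      - - (x * y)   ≈⟨ -‿involutive _ ⟩
      x * y         ∎

  *-pos-cancelˡ : ∀ {x y} → 0# < x → 0# < x * y → 0# < y
  *-pos-cancelˡ {x} {y} 0<x 0<xy with compare 0# y
  ... | tri< 0<y _ _ = 0<y
  ... | tri≈ _ 0≈y _ with () ← irrefl refl (<-respʳ (trans (*-congˡ (sym 0≈y)) (zeroʳ x)) 0<xy)
  ... | tri> _ _ y<0 with () ← pos-neg-absurd 0<xy
      (<-respʳ (sym (-‿distribʳ-* x y)) (*-pos 0<x (x<0⇒0<-x y<0)))

-- Alternation and Grassmann-Plücker relations for orientations

module Orientations {c ℓ₁ ℓ₂} (F : OrderedField c ℓ₁ ℓ₂) where
  open OrderedField F
  open Det F
  open IntegerCoefficients commutativeRing

  -- `combine j i` is 4j + i, so concatenating the coordinates point by point agrees with `row`.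
  env : ∀ {k} → Vec Point k → Vec Carrier (k ℕ.* 4)
  env ps = concat (Vec.map tabulate ps)

  orients : (ℤ → Point) → Tuple → Carrier
  orients p (a ∷ b ∷ c ∷ d ∷ e ∷ []) = orient (p a) (p b) (p c) (p d) (p e)

  -- Transposing the first two entries changes the base point of the differences; the other
  -- transpositions exchange two rows.
  orients-alternating : ∀ p i t → orients p (swap i t) ≈ - orients p t
  orients-alternating p i (a ∷ b ∷ c ∷ d ∷ e ∷ []) = go i
    where
    open DeterminantExpressions 5
    ρ = env (p a ∷ p b ∷ p c ∷ p d ∷ p e ∷ [])
    a′ = row (# 0) ; b′ = row (# 1) ; c′ = row (# 2) ; d′ = row (# 3) ; e′ = row (# 4)
    o = orientᴱ a′ b′ c′ d′ e′
    go : ∀ i → orients p (swap i (a ∷ b ∷ c ∷ d ∷ e ∷ [])) ≈ - orient (p a) (p b) (p c) (p d) (p e)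
    go zero                   = prove ρ (orientᴱ b′ a′ c′ d′ e′) (⊝ o) ≡.refl
    go (suc zero)             = prove ρ (orientᴱ a′ c′ b′ d′ e′) (⊝ o) ≡.refl
    go (suc (suc zero))       = prove ρ (orientᴱ a′ b′ d′ c′ e′) (⊝ o) ≡.refl
    go (suc (suc (suc zero))) = prove ρ (orientᴱ a′ b′ c′ e′ d′) (⊝ o) ≡.refl

  -- Modulo the span of independent u and v, the factors are 2×2 minors of four plane vectors up to
  -- a common scale. The order `x q` in the last factor gives both terms on the right a plus sign.
  det4-plücker : ∀ u v p q x y →
    det4 u v p q * det4 u v x y ≈ det4 u v p x * det4 u v q y + det4 u v p y * det4 u v x q
  det4-plücker u v p q x y = prove (env (u ∷ v ∷ p ∷ q ∷ x ∷ y ∷ []))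
    (det4ᴱ u′ v′ p′ q′ ⊗ det4ᴱ u′ v′ x′ y′)
    ((det4ᴱ u′ v′ p′ x′ ⊗ det4ᴱ u′ v′ q′ y′) ⊕ (det4ᴱ u′ v′ p′ y′ ⊗ det4ᴱ u′ v′ x′ q′)) ≡.refl
    where
    open DeterminantExpressions 6
    u′ = row (# 0) ; v′ = row (# 1) ; p′ = row (# 2)
    q′ = row (# 3) ; x′ = row (# 4) ; y′ = row (# 5)

  orients-plücker : ∀ p a b c u q x y →
    let [_,_] = λ v w → orients p (a ∷ b ∷ c ∷ v ∷ w ∷ []) in
    [ u , q ] * [ x , y ] ≈ [ u , x ] * [ q , y ] + [ u , y ] * [ x , q ]
  orients-plücker p a b c u q x y =
    det4-plücker (p b -ᵥ p a) (p c -ᵥ p a) (p u -ᵥ p a) (p q -ᵥ p a) (p x -ᵥ p a) (p y -ᵥ p a)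

-- Soundness of the deduction

-- Field values in place of signs keep Grassmann-Plücker an equation, and no coordinates enter the
-- propagation.
record SupportingChirotope {c ℓ₁ ℓ₂} (F : OrderedField c ℓ₁ ℓ₂) : Set (c ⊔ ℓ₁ ⊔ ℓ₂) where
  open OrderedField F hiding (zero) renaming (_<_ to infix 4 _<_)
  field
    χ           : Tuple → Carrier
    alternating : ∀ i t → χ (swap i t) ≈ - χ t
    grassmann-plücker : ∀ a b c p q x y →
      let [_,_] = λ u v → χ (a ∷ b ∷ c ∷ u ∷ v ∷ []) in
      [ p , q ] * [ x , y ] ≈ [ p , x ] * [ q , y ] + [ p , y ] * [ x , q ]
    same-side   : ∀ {a b c d w v} → Crossable a b c d w → v ∈ V → v ∉ (a ∷ b ∷ c ∷ d ∷ []) →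
      0# < χ (a ∷ b ∷ c ∷ d ∷ w ∷ []) * χ (a ∷ b ∷ c ∷ d ∷ v ∷ [])

module Propagation {c ℓ₁ ℓ₂} (F : OrderedField c ℓ₁ ℓ₂) (C : SupportingChirotope F) where
  open OrderedField F hiding (zero) renaming (_<_ to infix 4 _<_)
  open SupportingChirotope C
  open OrderedFieldProperties F
  open IntegerCoefficients commutativeRing using (prove)
  open import Algebra.Properties.Ring ring
  open import Relation.Binary.Reasoning.Setoid setoid

  r : Carrier
  r = χ seed

  -- The facet condition with -5 taken twice excludes a degenerate seed, so r can serve as a scale.
  0<r*r : 0# < r * r
  0<r*r = same-side seed-crossable w∈ w∉
    where
    seed-crossable : Crossable (pos 1) (pos 2) (pos 3) (pos 5) (neg 5)
    seed-crossable = toWitness {a? = crossable? (pos 1) (pos 2) (pos 3) (pos 5) (neg 5)} _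
    w∈ = proj₁ (proj₂ (proj₂ (proj₂ seed-crossable)))
    w∉ = proj₂ (proj₂ (proj₂ (proj₂ seed-crossable)))

  -- Scaling by r normalises the global sign of χ: the seed becomes positive.
  X : Tuple → Carrier
  X t = r * χ t

  X-alternating : ∀ i t → X (swap i t) ≈ - X t
  X-alternating i t = trans (*-congˡ (alternating i t)) (sym (-‿distribʳ-* r (χ t)))

  rescale-* : ∀ x y → (r * x) * (r * y) ≈ (r * r) * (x * y)
  rescale-* x y = prove (r ∷ x ∷ y ∷ [])
    ((Ι (# 0) ⊗ Ι (# 1)) ⊗ (Ι (# 0) ⊗ Ι (# 2)))
    ((Ι (# 0) ⊗ Ι (# 0)) ⊗ (Ι (# 1) ⊗ Ι (# 2))) ≡.refl

  -- Both sides are homogeneous of degree two, so scaling by r multiplies each by r².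
  X-plücker : ∀ a b c p q x y →
    let [_,_] = λ u v → X (a ∷ b ∷ c ∷ u ∷ v ∷ []) in
    [ p , q ] * [ x , y ] ≈ [ p , x ] * [ q , y ] + [ p , y ] * [ x , q ]
  X-plücker a b c u q x y = begin
    [ u , q ] * [ x , y ]                   ≈⟨ rescale-* _ _ ⟩
    (r * r) * (⟨ u , q ⟩ * ⟨ x , y ⟩)       ≈⟨ *-congˡ (grassmann-plücker a b c u q x y) ⟩
    (r * r) * (⟨ u , x ⟩ * ⟨ q , y ⟩ + ⟨ u , y ⟩ * ⟨ x , q ⟩) ≈⟨ distribˡ _ _ _ ⟩
    (r * r) * (⟨ u , x ⟩ * ⟨ q , y ⟩) + (r * r) * (⟨ u , y ⟩ * ⟨ x , q ⟩)
                                            ≈⟨ +-cong (rescale-* _ _) (rescale-* _ _) ⟨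
    [ u , x ] * [ q , y ] + [ u , y ] * [ x , q ] ∎
    where
    ⟨_,_⟩ [_,_] : ℤ → ℤ → Carrier
    ⟨ v , w ⟩ = χ (a ∷ b ∷ c ∷ v ∷ w ∷ [])
    [ v , w ] = X (a ∷ b ∷ c ∷ v ∷ w ∷ [])

  value : Bool × Tuple → Carrier
  value (true  , t) = X t
  value (false , t) = - X t

  -- The flipped bit offsets the sign change of the transposition, which makes `value` invariant
  -- under sorting.
  value-swap : ∀ s i t → value (not s , swap i t) ≈ value (s , t)
  value-swap true  i t = trans (-‿cong (X-alternating i t)) (-‿involutive _)
  value-swap false i t = X-alternating i t

  value-compareSwap : ∀ st i → value (compareSwap st i) ≈ value st
  value-compareSwap (s , t) i with lookup t (inject₁ i) ℤ.≤ᵇ lookup t (suc i)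
  ... | true  = refl
  ... | false = value-swap s i t

  value-foldl : ∀ is st → value (foldl compareSwap st is) ≈ value st
  value-foldl []       st = refl
  value-foldl (i ∷ is) st = trans (value-foldl is (compareSwap st i)) (value-compareSwap st i)

  X-unsign : ∀ st → X (unsign st) ≈ value st
  X-unsign (true  , t) = refl
  X-unsign (false , t) = X-alternating zero t

  X-sortEvenly : ∀ is t → X (sortEvenly is t) ≈ X t
  X-sortEvenly is t = trans (X-unsign (foldl compareSwap (true , t) is)) (value-foldl is (true , t))

  Sound : List Tuple → Set _
  Sound = All (λ t → 0# < X t)

  sortEvenly-pos : ∀ t → 0# < X t → 0# < X (sortEvenly bubbleSort t)
  sortEvenly-pos t = <-respʳ (sym (X-sortEvenly bubbleSort t))

  known-pos : ∀ {K} t → Sound K → Known K t → 0# < X t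
  known-pos t sound t∈ = <-respʳ (X-sortEvenly bubbleSort t) (All.lookup sound t∈)

  known-neg : ∀ {K} t → Sound K → Known K (swap zero t) → 0# < - X t
  known-neg t sound t∈ = <-respʳ (X-alternating zero t) (known-pos (swap zero t) sound t∈)

  sameSign-pos : ∀ {K} t u → Sound K → SameSign K t u → 0# < X t * X u
  sameSign-pos t u sound (inj₁ (t∈ , u∈)) = *-pos (known-pos t sound t∈) (known-pos u sound u∈)
  sameSign-pos t u sound (inj₂ (t∈ , u∈)) = *-pos-neg (known-neg t sound t∈) (known-neg u sound u∈)

  when-sound : ∀ {P ts} (P? : Dec P) → (P → Sound ts) → Sound (when P? ts)
  when-sound (yes p) sound = sound p
  when-sound (no _)  sound = []

  -- The facet condition times r² makes the product of the values of `X` at w and v positive;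
  -- cancelling the positive value at w leaves the one at v.
  cross-sound : ∀ {K} a b c d w → Sound K → Sound (cross K a b c d w)
  cross-sound {K} a b c d w sound = when-sound (crossPremises? K a b c d w) λ (known , crossable) →
    All.map⁺ (All.tabulate λ {v} v∈ →
      let v∈V , v∉F = ∈-filter⁻ (λ v → ¬? (v ∈ℤ? (a ∷ b ∷ c ∷ d ∷ []))) {xs = V} v∈ in
      sortEvenly-pos (a ∷ b ∷ c ∷ d ∷ v ∷ []) (*-pos-cancelˡ (known-pos (a ∷ b ∷ c ∷ d ∷ w ∷ []) sound known)
        (<-respʳ (sym (rescale-* _ _)) (*-pos 0<r*r (same-side crossable v∈V v∉F)))))

  resolve-sound : ∀ {K} a b c p q x y → Sound K → Sound (resolve K a b c p q x y)
  resolve-sound {K} a b c p q x y sound = when-sound (resolvePremises? K a b c p q x y) λ (pq , px-qy , py-xq) →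
    sortEvenly-pos (a ∷ b ∷ c ∷ x ∷ y ∷ []) (*-pos-cancelˡ (known-pos (a ∷ b ∷ c ∷ p ∷ q ∷ []) sound pq)
      (<-respʳ (sym (X-plücker a b c p q x y))
        (+-pos (sameSign-pos (a ∷ b ∷ c ∷ p ∷ x ∷ []) (a ∷ b ∷ c ∷ q ∷ y ∷ []) sound px-qy)
               (sameSign-pos (a ∷ b ∷ c ∷ p ∷ y ∷ []) (a ∷ b ∷ c ∷ x ∷ q ∷ []) sound py-xq)))) ∷ []

  extend-sound : ∀ {K} s → Sound K → Sound (extend K s)
  extend-sound (facet a b c d w)       sound =
    All.++⁺ (cross-sound a b c d w sound) (All.++⁺ (cross-sound b a c d w sound) sound)
  extend-sound (plücker a b c p q x y) sound = All.++⁺ (resolve-sound a b c p q x y sound) sound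

  foldl-sound : ∀ {K} steps → Sound K → Sound (foldl extend K steps)
  foldl-sound []          sound = sound
  foldl-sound (s ∷ steps) sound = foldl-sound steps (extend-sound s sound)

  consequences-sound : ∀ t steps → 0# < X t → Sound (consequences t steps)
  consequences-sound t steps 0<Xt =
    foldl-sound (crossings ++ map antipode crossings ++ steps)
      (sortEvenly-pos seed 0<r*r ∷ sortEvenly-pos t 0<Xt ∷ [])

  refute : ∀ t steps u → 0# < X t → Contradictory (consequences t steps) u → ⊥
  refute t steps u 0<Xt (u∈ , u′∈) = pos-neg-absurd (known-pos u sound u∈) (known-neg u sound u′∈)
    where sound = consequences-sound t steps 0<Xt

  -- Rules out the middle case of the trichotomy in `inconsistent`; the vertex 5 is taken twice.
  0<χ²-antiSeed : 0# < χ antiSeed * χ antiSeed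
  0<χ²-antiSeed = same-side crossable w∈ w∉
    where
    crossable : Crossable (neg 2) (neg 1) (neg 3) (neg 5) (pos 5)
    crossable = toWitness {a? = crossable? (neg 2) (neg 1) (neg 3) (neg 5) (pos 5)} _
    w∈ = proj₁ (proj₂ (proj₂ (proj₂ crossable)))
    w∉ = proj₂ (proj₂ (proj₂ (proj₂ crossable)))

  inconsistent : ⊥
  inconsistent with compare 0# (X antiSeed)
  ... | tri< 0<X _ _ = refute antiSeed resolutions₊ witness₊ 0<X contradiction₊
  ... | tri≈ _ 0≈X _ =
    irrefl refl (<-respʳ (trans (*-congʳ (sym 0≈X)) (zeroˡ _))
      (<-respʳ (sym (rescale-* _ _)) (*-pos 0<r*r 0<χ²-antiSeed)))
  -- Here the antipode of `seed` has the sign of `seed`, as in every realization with p(-v) = -p(v).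
  ... | tri> _ _ X<0 = refute (swap zero antiSeed) resolutions₋ witness₋
    (<-respʳ (sym (X-alternating zero antiSeed)) (x<0⇒0<-x X<0)) contradiction₋

-- From a realization to a chirotope

module Realization {c ℓ₁ ℓ₂} (F : OrderedField c ℓ₁ ℓ₂) (k : ℕ)
                   (p : ℤ → Det.Point F) (realizes : RealizesΔ F (5 ℕ.+ k) p) where
  open OrderedField F hiding (zero) renaming (_<_ to infix 4 _<_)
  open Orientations F

  V⊆vertices : V ⊆ vertices (5 ℕ.+ k)
  V⊆vertices = ⊆.++⁺ (⊆.map⁺ pos range⊆) (⊆.map⁺ neg range⊆)
    where
    range⊆ : range 1 5 ⊆ range 1 (5 ℕ.+ k)
    range⊆ = ⊆.map⁺ (1 ℕ.+_) λ i∈ → ∈-upTo⁺ (ℕ.≤-trans (∈-upTo⁻ i∈) (ℕ.m≤m+n 5 k))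

  facetsFixed⊆facetsΔ : facetsFixed ⊆ facetsΔ (5 ℕ.+ k)
  facetsFixed⊆facetsΔ = ⊆.++⁺ half⊆ (⊆.map⁺ _ half⊆)
    where
    half⊆ : facetsBℓ 5 ++ facetsC ⊆ facetsA (5 ℕ.+ k) ++ facetsB (5 ℕ.+ k) ++ facetsC
    -- The range from 5 to 5 + k reduces to a list headed by 5, so `facetsB` begins with
    -- `facetsBℓ 5` by computation.
    half⊆ = ⊆.⊆-trans (⊆.++⁺ (⊆.xs⊆xs++ys (facetsBℓ 5) _) ⊆.⊆-refl)
                      (⊆.xs⊆ys++xs (facetsB (5 ℕ.+ k) ++ facetsC) (facetsA (5 ℕ.+ k)))

  same-side : ∀ {a b c d w v} → Crossable a b c d w → v ∈ V → v ∉ (a ∷ b ∷ c ∷ d ∷ []) →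
    0# < orients p (a ∷ b ∷ c ∷ d ∷ w ∷ []) * orients p (a ∷ b ∷ c ∷ d ∷ v ∷ [])
  same-side {a} {b} {c} {d} {w} {v} (F∈ , distinct , (a∈ ∷ b∈ ∷ c∈ ∷ d∈ ∷ []) , w∈ , w∉) v∈ v∉ =
    Equivalence.to (realizes a b c d (V⊆vertices a∈) (V⊆vertices b∈) (V⊆vertices c∈) (V⊆vertices d∈) distinct)
      (⊆.Any-resp-⊆ facetsFixed⊆facetsΔ F∈) w v (V⊆vertices w∈) (V⊆vertices v∈) w∉ v∉

  unrealizable : ⊥
  unrealizable = Propagation.inconsistent F record
    { χ                 = orients p
    ; alternating       = orients-alternating p
    ; grassmann-plücker = orients-plücker p
    ; same-side         = same-side
    }

theorem5p11 : ∀ {c ℓ₁ ℓ₂} (ℝ : OrderedField c ℓ₁ ℓ₂) → IsComplete ℝ →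
    ∀ (n : ℕ) → 5 ≤ n → ¬ PolytopalOver ℝ n
theorem5p11 ℝ _ (suc (suc (suc (suc (suc k)))))
  (ℕ.s≤s (ℕ.s≤s (ℕ.s≤s (ℕ.s≤s (ℕ.s≤s _))))) (p , realizes) =
  Realization.unrealizable ℝ k p realizes
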